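{- Let $\lambda_1,\kappa_1,\lambda_2,\kappa_2\in\mathbb{F}_q((T^{ -1}))$, let $L_j(\underline{P}) := \lambda_j P_1 + \kappa_j P_2$ for $j=1,2$ and $\underline{P}=(P_1,P_2)$, and suppose $\Delta := |\lambda_1\kappa_2 - \lambda_2\kappa_1| > 0$. (1) For all $\rho_1,\rho_2 \in \mathbb{F}_q((T^{ -1}))$ there exists $\underline{Q}\in\mathbb{F}_q[T]^2$ such that \[ |L_1(\underline{Q}) + \rho_1|\,|L_2(\underline{Q}) + \rho_2| \leq q^{ -2}\Delta. \] (2) If moreover $\kappa_1\lambda_1^{ -1} \notin \mathbb{F}_q(T)$ and $k\in\mathbb{N}$, then there exists such a $\underline{Q}$ which in addition satisfies \[ \deg\big(L_1(\underline{Q}) + \rho_1\big) < -k. \]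
   Context: $\mathbb{F}_q((T^{ -1}))$ is the field of formal Laurent series in $T^{ -1}$ over the finite field $\mathbb{F}_q$; for nonzero $x$, $\deg x$ is the largest $n$ with nonzero coefficient of $T^n$ and $|x|=q^{\deg x}$; $|0|=0$ and $\deg 0=-\infty$. -}

module Defs where

open import Data.Nat as ℕ using (ℕ; zero; suc)
open import Data.Integer as ℤ using (ℤ; +_; -[1+_]; _<_; _≤_)
open import Data.Integer.Properties using (_<?_)
open import Data.Fin using (Fin)
open import Data.List using (List; []; _∷_)
open import Data.Maybe using (Maybe; just; nothing)
open import Data.Product using (Σ; _×_; _,_)
open import Data.Empty using (⊥; ⊥-elim)
open import Data.Unit using (⊤)
open import Relation.Nullary using (¬_; Dec; yes; no)
open import Relation.Binary.PropositionalEquality using (_≡_; _≢_; refl)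
open import Relation.Binary.Definitions using (DecidableEquality)
open import Algebra.Structures using (IsCommutativeRing)
open import Function.Bundles using (_↔_)

record FiniteField (q : ℕ) : Set₁ where
  field
    F     : Set
    _≟F_  : DecidableEquality F
    _+F_  : F → F → F
    _*F_  : F → F → F
    -F_   : F → F
    0F    : F
    1F    : F
    isCommutativeRing : IsCommutativeRing _≡_ _+F_ _*F_ -F_ 0F 1F
    0≢1   : 0F ≢ 1F
    invF  : (x : F) → x ≢ 0F → F
    invF-correct : (x : F) (p : x ≢ 0F) → x *F invF x p ≡ 1F
    enumeration : F ↔ Fin q

module _ {A : Set} (_⊕_ : A → A → A) (e : A) where
  sumRange : ℤ → ℕ → (ℤ → A) → A
  sumRange s zero    f = e
  sumRange s (suc l) f = f s ⊕ sumRange (s ℤ.+ + 1) l f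

toℕ⁺ : ℤ → ℕ
toℕ⁺ (+ n)     = n
toℕ⁺ -[1+ n ]  = 0

module LaurentOps {q : ℕ} (K : FiniteField q) where
  open FiniteField K

  -- x = Σ_{n ≤ bound} coeff n · Tⁿ
  record Laurent : Set where
    field
      coeff  : ℤ → F
      bound  : ℤ
      vanish : ∀ n → bound < n → coeff n ≡ 0F
  open Laurent public

  private
    trunc : (ℤ → F) → (b n : ℤ) → Dec (b < n) → F
    trunc raw b n (yes _) = 0F
    trunc raw b n (no _)  = raw n

    trunc-vanish : (raw : ℤ → F) (b n : ℤ) (p : b < n) (d : Dec (b < n)) → trunc raw b n d ≡ 0F
    trunc-vanish raw b n p (yes _) = refl
    trunc-vanish raw b n p (no ¬p) = ⊥-elim (¬p p)

  mkL : (ℤ → F) → ℤ → Laurent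
  mkL raw b = record
    { coeff  = λ n → trunc raw b n (b <? n)
    ; bound  = b
    ; vanish = λ n p → trunc-vanish raw b n p (b <? n) }

  _+L_ : Laurent → Laurent → Laurent
  x +L y = mkL (λ n → coeff x n +F coeff y n) (bound x ℤ.⊔ bound y)

  -L_ : Laurent → Laurent
  -L x = mkL (λ n → -F coeff x n) (bound x)

  _-L_ : Laurent → Laurent → Laurent
  x -L y = x +L (-L y)

  -- Cauchy product: (xy)_n = Σ_{i = n - bound y}^{bound x} x_i y_{n-i}
  _*L_ : Laurent → Laurent → Laurent
  x *L y = mkL (λ n → sumRange _+F_ 0F (n ℤ.- bound y)
                        (toℕ⁺ (bound x ℤ.+ bound y ℤ.- n ℤ.+ + 1))
                        (λ i → coeff x i *F coeff y (n ℤ.- i)))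
               (bound x ℤ.+ bound y)

  -- Polynomials F_q[T] (coefficient lists, constant term first) embedded in F_q((T⁻¹)).
  Poly : Set
  Poly = List F

  coeffPoly : Poly → ℕ → F
  coeffPoly []       _       = 0F
  coeffPoly (a ∷ as) zero    = a
  coeffPoly (a ∷ as) (suc n) = coeffPoly as n

  lenPoly : Poly → ℕ
  lenPoly []       = 0
  lenPoly (_ ∷ as) = suc (lenPoly as)

  polyL : Poly → Laurent
  polyL p = mkL (λ { (+ n) → coeffPoly p n ; -[1+ n ] → 0F }) (+ lenPoly p)

  _≈L_ : Laurent → Laurent → Set
  x ≈L y = ∀ n → coeff x n ≡ coeff y n

  IsZero : Laurent → Set
  IsZero x = ∀ n → coeff x n ≡ 0F

  -- degree: HasDeg x d  means  deg x = d, with nothing = -∞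
  HasDeg : Laurent → Maybe ℤ → Set
  HasDeg x nothing  = IsZero x
  HasDeg x (just d) = (coeff x d ≢ 0F) × (∀ m → d < m → coeff x m ≡ 0F)

  -- κ l⁻¹ ∈ F_q(T)  (for l ≠ 0):  κ l⁻¹ = a / b  with a, b ∈ F_q[T], b ≠ 0
  QuotientRational : Laurent → Laurent → Set
  QuotientRational κ l = Σ Poly (λ a → Σ Poly (λ b →
    ¬ IsZero (polyL b) × ((polyL b *L κ) ≈L (polyL a *L l))))

-- Extended integers ℤ ∪ {-∞} (values of deg = log_q |·|)

_+∞_ : Maybe ℤ → Maybe ℤ → Maybe ℤ
just a  +∞ just b = just (a ℤ.+ b)
_       +∞ _      = nothing

_≤∞_ : Maybe ℤ → Maybe ℤ → Set
nothing ≤∞ _       = ⊤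
just a  ≤∞ nothing = ⊥
just a  ≤∞ just b  = a ≤ b

_<∞_ : Maybe ℤ → Maybe ℤ → Set
nothing <∞ nothing = ⊥
nothing <∞ just _  = ⊤
just a  <∞ nothing = ⊥
just a  <∞ just b  = a < b

{-# OPTIONS --safe #-}
-- The vectors (L₁ Q, L₂ Q) form a lattice whose bases (v, w) all have determinants
-- v₁w₂ - v₂w₁ of degree e = log_q Δ.  Euclid's algorithm on the first coordinates keeps
-- deg w₁ < deg v₁ = d and second coordinates of degree at most B.  If d + B > e, then w₂ has
-- degree below B, since otherwise the determinant would have degree d + B; hence every division
-- step lowers d + B by one until d + B = e, and from then on d + B stays equal to e while d
-- decreases.  When d + B = e, the leading coefficients of v₁ and w₂ do not vanish, and
-- subtracting monomial multiples of v and w alternately moves any point of the plane into the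
-- box deg x₁ < d, deg x₂ < B, where deg x₁ + deg x₂ ≤ e - 2.  The algorithm can only stop early
-- at w₁ = 0: then κ₁/λ₁ is rational (if λ₁ ≠ 0), deg v₁ + deg w₂ = e, and one reduces x₁ by v
-- and afterwards x₂ by w.
module Submission where

open import Defs
open import Level using (0ℓ)
open import Algebra.Bundles using (CommutativeRing)
import Algebra.Properties.CommutativeSemigroup as CommutativeSemigroupProperties
import Algebra.Properties.Ring as RingProperties
open import Axiom.ExcludedMiddle using (ExcludedMiddle)
open import Data.Empty using (⊥-elim)
open import Data.Integer using (ℤ; +_; -[1+_]; -_; _-_; _+_; _≤_; _<_; +<+; +≤+; -≤+; _⊔_; _⊓_; ∣_∣)
import Data.Integer.Properties as ℤ
open import Data.Integer.Tactic.RingSolver using (solve-∀)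
open import Data.List using ([]; _∷_; map)
open import Data.Maybe using (just; nothing)
open import Data.Nat as ℕ using (ℕ; zero; suc)
import Data.Nat.Properties as ℕ
open import Data.Product using (Σ; ∃; _×_; _,_; proj₁; proj₂)
open import Data.Sum using (_⊎_; inj₁; inj₂)
open import Data.Unit using (tt)
open import Relation.Nullary using (¬_; Dec; yes; no)
open import Relation.Binary.PropositionalEquality using (_≡_; _≢_; refl; sym; trans; cong; cong₂; subst; module ≡-Reasoning)

-- Integer inequalities derived from equations between differences.

≤-shift : ∀ {i j k l} → i ≤ j → j - i ≡ l - k → k ≤ l
≤-shift i≤j eq = ℤ.0≤i-j⇒j≤i (subst (+ 0 ≤_) eq (ℤ.i≤j⇒0≤j-i i≤j))

<-shift : ∀ {i j k l} → i < j → j - i ≡ l - k → k < l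
<-shift {i} {j} {k} {l} i<j eq =
  ℤ.suc[i]≤j⇒i<j (≤-shift (ℤ.i<j⇒suc[i]≤j i<j) (trans (e j i) (trans (cong (_- + 1) eq) (sym (e l k)))))
  where
  e : ∀ a b → a - (+ 1 + b) ≡ a - b - + 1
  e = solve-∀

-- Over the integers `i < j` means that `j - i` is at least 1, and this 1 pays for the `+ 1` in the
-- equation.
<-shift⇒≤ : ∀ {i j k l} → i < j → j - i ≡ l - k + + 1 → k ≤ l
<-shift⇒≤ {i} {j} {k} {l} i<j eq = ≤-shift (ℤ.i<j⇒suc[i]≤j i<j) (trans (e₁ i j) (trans (cong (_- + 1) eq) (e₂ k l)))
  where
  e₁ : ∀ a b → b - (+ 1 + a) ≡ b - a - + 1
  e₁ = solve-∀
  e₂ : ∀ k l → l - k + + 1 - + 1 ≡ l - k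
  e₂ = solve-∀

≤-shift⇒< : ∀ {i j k l} → i ≤ j → j - i + + 1 ≡ l - k → k < l
≤-shift⇒< {i} {j} {k} {l} i≤j eq = ℤ.suc[i]≤j⇒i<j (≤-shift i≤j (trans (e₁ i j) (trans (cong (_- + 1) eq) (e₂ k l))))
  where
  e₁ : ∀ a b → b - a ≡ b - a + + 1 - + 1
  e₁ = solve-∀
  e₂ : ∀ k l → l - k - + 1 ≡ l - (+ 1 + k)
  e₂ = solve-∀

≤-gap : ∀ {i j} → i ≤ j → ∃ λ n → j ≡ i + + n
≤-gap {i} {j} i≤j = ∣ j - i ∣ , sym (trans (cong (λ x → i + x) (ℤ.0≤i⇒+∣i∣≡i (ℤ.i≤j⇒0≤j-i i≤j))) (e i j))
  where
  e : ∀ i j → i + (j - i) ≡ j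
  e = solve-∀

≤-within : ∀ i j → ∃ λ n → j ≤ i + + n
≤-within i j with ℤ.≤-total j i
... | inj₁ j≤i = 0 , ℤ.≤-trans j≤i (ℤ.≤-reflexive (sym (ℤ.+-identityʳ i)))
... | inj₂ i≤j with ≤-gap i≤j
...   | n , eq = n , ℤ.≤-reflexive eq

<-within : ∀ a s → ∃ λ l → a < s + + l
<-within a s with ≤-within s a
... | l , a≤s+l = suc l , ≤-shift⇒< a≤s+l (e a s (+ l))
  where
  e : ∀ a s l → s + l - a + + 1 ≡ s + (+ 1 + l) - a
  e = solve-∀

i≤i+n : ∀ i n → i ≤ i + + n
i≤i+n i n = ℤ.i≤i+j i (+ n)

i≤toℕ⁺ : ∀ i → i ≤ + toℕ⁺ i
i≤toℕ⁺ (+ n) = ℤ.≤-refl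
i≤toℕ⁺ -[1+ n ] = -≤+

module Series {q} (K : FiniteField q) where
  open FiniteField K public
  open LaurentOps K public

  ring : CommutativeRing _ _
  ring = record { isCommutativeRing = isCommutativeRing }

  open CommutativeRing ring public
    using (+-assoc; +-comm; +-identityˡ; +-identityʳ; -‿inverseʳ; *-assoc; *-comm; *-identityˡ; *-identityʳ;
           distribˡ; zeroˡ; zeroʳ)
  open RingProperties (CommutativeRing.ring ring) public
    using (-0#≈0#; -1*x≈-x; -‿+-comm; -‿involutive; +-inverseʳ-unique)
  open CommutativeSemigroupProperties (CommutativeRing.+-commutativeSemigroup ring) public
    using () renaming (interchange to +-interchange; xy∙z≈xz∙y to +-swapʳ)
  open CommutativeSemigroupProperties (CommutativeRing.*-commutativeSemigroup ring) public
    using () renaming (x∙yz≈y∙xz to x*yz≡y*xz)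

  -- Finite sums over ranges of integers.

  ∑ : ℤ → ℕ → (ℤ → F) → F
  ∑ = sumRange _+F_ 0F

  ∑-cong : ∀ {f g} s l → (∀ i → f i ≡ g i) → ∑ s l f ≡ ∑ s l g
  ∑-cong s zero    f≡g = refl
  ∑-cong s (suc l) f≡g = cong₂ _+F_ (f≡g s) (∑-cong (s + + 1) l f≡g)

  ∑-zero : ∀ {f} s l → (∀ i → s ≤ i → i < s + + l → f i ≡ 0F) → ∑ s l f ≡ 0F
  ∑-zero s zero    f≡0 = refl
  ∑-zero {f} s (suc l) f≡0 = trans
    (cong₂ _+F_ (f≡0 s ℤ.≤-refl (≤-shift⇒< (i≤i+n s l) (e₁ s (+ l))))
      (∑-zero (s + + 1) l λ i s≤i i<l →
        f≡0 i (ℤ.≤-trans (i≤i+n s 1) s≤i) (ℤ.<-≤-trans i<l (ℤ.≤-reflexive (e₂ s (+ l))))))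
    (+-identityˡ 0F)
    where
    e₁ : ∀ s l → s + l - s + + 1 ≡ s + (+ 1 + l) - s
    e₁ = solve-∀
    e₂ : ∀ s l → s + + 1 + l ≡ s + (+ 1 + l)
    e₂ = solve-∀

  ∑-split : ∀ {f} s k l → ∑ s (k ℕ.+ l) f ≡ ∑ s k f +F ∑ (s + + k) l f
  ∑-split {f} s zero l = sym (trans (+-identityˡ _) (cong (λ t → ∑ t l f) (ℤ.+-identityʳ s)))
  ∑-split {f} s (suc k) l = trans
    (cong (f s +F_) (trans (∑-split (s + + 1) k l)
      (cong (λ t → ∑ (s + + 1) k f +F ∑ t l f) (e s (+ k)))))
    (sym (+-assoc _ _ _))
    where
    e : ∀ s k → s + + 1 + k ≡ s + (+ 1 + k)
    e = solve-∀

  ∑-snoc : ∀ {f} s l → ∑ s (suc l) f ≡ ∑ s l f +F f (s + + l)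
  ∑-snoc {f} s l = trans (cong (λ k → ∑ s k f) (ℕ.+-comm 1 l))
    (trans (∑-split s l 1) (cong (∑ s l f +F_) (+-identityʳ _)))

  ∑-+ : ∀ {f g} s l → ∑ s l (λ i → f i +F g i) ≡ ∑ s l f +F ∑ s l g
  ∑-+ s zero    = sym (+-identityˡ 0F)
  ∑-+ s (suc l) = trans (cong (_ +F_) (∑-+ (s + + 1) l)) (+-interchange _ _ _ _)

  ∑-* : ∀ {f} c s l → ∑ s l (λ i → c *F f i) ≡ c *F ∑ s l f
  ∑-* c s zero    = sym (zeroʳ c)
  ∑-* c s (suc l) = trans (cong (_ +F_) (∑-* c (s + + 1) l)) (sym (distribˡ c _ _))

  -- The substitution of `n - i` for `i` carries the range from `s` to `s + l - 1` onto the range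
  -- from `n + 1 - s - l` to `n - s`. It exchanges the two factors of a Cauchy product.
  ∑-reverse : ∀ {f} n s l → ∑ s l f ≡ ∑ (n + + 1 - s - + l) l (λ i → f (n - i))
  ∑-reverse n s zero = refl
  ∑-reverse {f} n s (suc l) = begin
    f s +F ∑ (s + + 1) l f                        ≡⟨ +-comm _ _ ⟩
    ∑ (s + + 1) l f +F f s                        ≡⟨ cong₂ _+F_ (∑-reverse n (s + + 1) l) (cong f (e₁ n s (+ l))) ⟩
    ∑ (n + + 1 - (s + + 1) - + l) l g +F g (t + + l) ≡⟨ cong (λ u → ∑ u l g +F g (t + + l)) (e₂ n s (+ l)) ⟩
    ∑ t l g +F g (t + + l)                        ≡⟨ ∑-snoc t l ⟨
    ∑ t (suc l) g                                 ∎
    where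
    open ≡-Reasoning
    g = λ i → f (n - i)
    t = n + + 1 - s - + suc l
    e₁ : ∀ n s l → s ≡ n - (n + + 1 - s - (+ 1 + l) + l)
    e₁ = solve-∀
    e₂ : ∀ n s l → n + + 1 - (s + + 1) - l ≡ n + + 1 - s - (+ 1 + l)
    e₂ = solve-∀

  Support : (ℤ → F) → ℤ → ℕ → Set
  Support f s l = (∀ i → i < s → f i ≡ 0F) × (∀ i → s + + l ≤ i → f i ≡ 0F)

  private
    -- With `s′ = s + k`, both ranges lie in the one of length `k + l′ + l` that starts at `s`, and
    -- extending either sum to that range adds only zeros.
    ∑-support-≤ : ∀ {f s l s′ l′} → s ≤ s′ → Support f s l → Support f s′ l′ → ∑ s l f ≡ ∑ s′ l′ f
    ∑-support-≤ {f} {s} {l} {s′} {l′} s≤s′ (_ , right) (left′ , right′) with ≤-gap s≤s′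
    ... | k , refl = begin
      ∑ s l f                                     ≡⟨ +-identityʳ _ ⟨
      ∑ s l f +F 0F                               ≡⟨ cong (∑ s l f +F_) (∑-zero (s + + l) (k ℕ.+ l′) λ i s≤i _ → right i s≤i) ⟨
      ∑ s l f +F ∑ (s + + l) (k ℕ.+ l′) f         ≡⟨ ∑-split s l (k ℕ.+ l′) ⟨
      ∑ s (l ℕ.+ (k ℕ.+ l′)) f                    ≡⟨ cong (λ m → ∑ s m f) (trans (ℕ.+-comm l _) (ℕ.+-assoc k l′ l)) ⟩
      ∑ s (k ℕ.+ (l′ ℕ.+ l)) f                    ≡⟨ ∑-split s k (l′ ℕ.+ l) ⟩
      ∑ s k f +F ∑ s′ (l′ ℕ.+ l) f                ≡⟨ cong₂ _+F_ (∑-zero s k λ i _ i<k → left′ i i<k) (∑-split s′ l′ l) ⟩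
      0F +F (∑ s′ l′ f +F ∑ (s′ + + l′) l f)      ≡⟨ +-identityˡ _ ⟩
      ∑ s′ l′ f +F ∑ (s′ + + l′) l f              ≡⟨ cong (∑ s′ l′ f +F_) (∑-zero (s′ + + l′) l λ i s≤i _ → right′ i s≤i) ⟩
      ∑ s′ l′ f +F 0F                             ≡⟨ +-identityʳ _ ⟩
      ∑ s′ l′ f                                   ∎
      where open ≡-Reasoning

  ∑-support : ∀ {f s l s′ l′} → Support f s l → Support f s′ l′ → ∑ s l f ≡ ∑ s′ l′ f
  ∑-support {s = s} {s′ = s′} σ σ′ with ℤ.≤-total s s′
  ... | inj₁ s≤s′ = ∑-support-≤ s≤s′ σ σ′
  ... | inj₂ s′≤s = sym (∑-support-≤ s′≤s σ′ σ)

  -- Coefficients of sums, and upper bounds for degrees.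

  coeff-mkL : ∀ {f b} → (∀ n → b < n → f n ≡ 0F) → ∀ n → coeff (mkL f b) n ≡ f n
  coeff-mkL {f} {b} f≡0 n with b ℤ.<? n
  ... | yes b<n = sym (f≡0 n b<n)
  ... | no  _   = refl

  coeff-+ : ∀ x y n → coeff (x +L y) n ≡ coeff x n +F coeff y n
  coeff-+ x y = coeff-mkL λ n b<n → trans
    (cong₂ _+F_ (vanish x n (ℤ.≤-<-trans (ℤ.i≤i⊔j _ _) b<n)) (vanish y n (ℤ.≤-<-trans (ℤ.i≤j⊔i _ _) b<n)))
    (+-identityˡ 0F)

  coeff-neg : ∀ x n → coeff (-L x) n ≡ -F coeff x n
  coeff-neg x = coeff-mkL λ n b<n → trans (cong -F_ (vanish x n b<n)) -0#≈0#

  coeff-sub : ∀ x y n → coeff (x -L y) n ≡ coeff x n +F (-F coeff y n)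
  coeff-sub x y n = trans (coeff-+ x (-L y) n) (cong (coeff x n +F_) (coeff-neg y n))

  infix 4 _≼_

  -- An upper bound for the degree that may differ from the stored `bound` and also makes sense for
  -- zero. As a record it lets `x` and `b` be inferred from a proof.
  record _≼_ (x : Laurent) (b : ℤ) : Set where
    constructor deg≤
    field above : ∀ n → b < n → coeff x n ≡ 0F
  open _≼_ public

  ≼-bound : ∀ x → x ≼ bound x
  ≼-bound x = deg≤ (vanish x)

  ≼-weaken : ∀ {x a b} → a ≤ b → x ≼ a → x ≼ b
  ≼-weaken a≤b x≼a = deg≤ λ n b<n → above x≼a n (ℤ.≤-<-trans a≤b b<n)

  -- The Cauchy product and its linearity.

  term : Laurent → Laurent → ℤ → ℤ → F
  term x y n i = coeff x i *F coeff y (n - i)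

  term-right : ∀ {x a} → x ≼ a → ∀ y n i → a < i → term x y n i ≡ 0F
  term-right x≼a y n i a<i = trans (cong (_*F coeff y (n - i)) (above x≼a i a<i)) (zeroˡ _)

  term-left : ∀ {y b} x → y ≼ b → ∀ n i → i < n - b → term x y n i ≡ 0F
  term-left {b = b} x y≼b n i i<n-b =
    trans (cong (coeff x i *F_) (above y≼b (n - i) (<-shift i<n-b (e n i b)))) (zeroʳ _)
    where
    e : ∀ n i b → n - b - i ≡ n - i - b
    e = solve-∀

  term-support : ∀ {x y a b} → x ≼ a → y ≼ b → ∀ n {s l} → s ≤ n - b → a < s + + l → Support (term x y n) s l
  term-support {x} {y} x≼a y≼b n s≤n-b a<s+l =
    (λ i i<s → term-left x y≼b n i (ℤ.<-≤-trans i<s s≤n-b)) ,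
    (λ i s+l≤i → term-right x≼a y n i (ℤ.<-≤-trans a<s+l s+l≤i))

  private
    n-a-b : ∀ a b n → n - (a + b) ≡ n - b - a
    n-a-b = solve-∀

  -- The product is defined with a range dictated by the `bound` fields. Any range containing all
  -- nonzero terms gives the same coefficient, so later arguments choose the range that suits them.
  coeff-* : ∀ x y n {s l} → Support (term x y n) s l → coeff (x *L y) n ≡ ∑ s l (term x y n)
  coeff-* x y n {s} {l} σ = trans (coeff-mkL high n) (∑-support standard σ)
    where
    high : ∀ n → bound x + bound y < n →
           ∑ (n - bound y) (toℕ⁺ (bound x + bound y - n + + 1)) (term x y n) ≡ 0F
    high n b<n = ∑-zero {term x y n} (n - bound y) (toℕ⁺ (bound x + bound y - n + + 1)) λ i s≤i _ →
      term-right (≼-bound x) y n i (ℤ.<-≤-trans (<-shift b<n (n-a-b (bound x) (bound y) n)) s≤i)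
    e : ∀ a b n → a - a + + 1 ≡ n - b + (a + b - n + + 1) - a
    e = solve-∀
    standard : Support (term x y n) (n - bound y) (toℕ⁺ (bound x + bound y - n + + 1))
    standard = term-support (≼-bound x) (≼-bound y) n ℤ.≤-refl
      (ℤ.<-≤-trans (≤-shift⇒< (ℤ.≤-refl {bound x}) (e (bound x) (bound y) n))
        (ℤ.+-monoʳ-≤ (n - bound y) (i≤toℕ⁺ (bound x + bound y - n + + 1))))

  ≼-* : ∀ {x y a b} → x ≼ a → y ≼ b → (x *L y) ≼ (a + b)
  ≼-* {x} {y} {a} {b} x≼a y≼b = deg≤ λ n a+b<n →
    -- Every index is above `a` or below `n - b`, so the empty range already contains the support.
    coeff-* x y n {a + + 1} {0} (term-support x≼a y≼b n
      (<-shift⇒≤ a+b<n (e₁ a b n)) (≤-shift⇒< (ℤ.≤-refl {a}) (e₂ a)))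
    where
    e₁ : ∀ a b n → n - (a + b) ≡ n - b - (a + + 1) + + 1
    e₁ = solve-∀
    e₂ : ∀ a → a - a + + 1 ≡ a + + 1 + + 0 - a
    e₂ = solve-∀

  coeff-*-top : ∀ {x y a b} → x ≼ a → y ≼ b → coeff (x *L y) (a + b) ≡ coeff x a *F coeff y b
  coeff-*-top {x} {y} {a} {b} x≼a y≼b = trans
    -- In degree `a + b` only the index `a` contributes, so a range of length one suffices.
    (coeff-* x y (a + b) {a} {1} (term-support x≼a y≼b (a + b)
      (ℤ.≤-reflexive (e₁ a b)) (≤-shift⇒< (ℤ.≤-refl {a}) (e₂ a))))
    (trans (+-identityʳ _) (cong (λ i → coeff x a *F coeff y i) (e₃ a b)))
    where
    e₁ : ∀ a b → a ≡ a + b - b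
    e₁ = solve-∀
    e₂ : ∀ a → a - a + + 1 ≡ a + + 1 - a
    e₂ = solve-∀
    e₃ : ∀ a b → a + b - a ≡ b
    e₃ = solve-∀

  *L-comm : ∀ x y → (x *L y) ≈L (y *L x)
  *L-comm x y n with <-within (bound x) (n - bound y)
  ... | l , bx<s+l = begin
    coeff (x *L y) n                      ≡⟨ coeff-* x y n {s} {l} σ ⟩
    ∑ s l (term x y n)                    ≡⟨ ∑-reverse n s l ⟩
    ∑ s′ l (λ i → term x y n (n - i))     ≡⟨ ∑-cong s′ l swap ⟩
    ∑ s′ l (term y x n)                   ≡⟨ coeff-* y x n {s′} {l} σ′ ⟨
    coeff (y *L x) n                      ∎
    where
    open ≡-Reasoning
    s  = n - bound y
    s′ = n + + 1 - s - + l
    σ : Support (term x y n) s l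
    σ = term-support (≼-bound x) (≼-bound y) n ℤ.≤-refl bx<s+l
    e₁ : ∀ n i → n - (n - i) ≡ i
    e₁ = solve-∀
    swap : ∀ i → term x y n (n - i) ≡ term y x n i
    swap i = trans (*-comm _ _) (cong (λ j → coeff y j *F coeff x (n - i)) (e₁ n i))
    e₂ : ∀ n a b l → n - b + l - a ≡ n - a - (n + + 1 - (n - b) - l) + + 1
    e₂ = solve-∀
    e₃ : ∀ n b l → b - b + + 1 ≡ n + + 1 - (n - b) - l + l - b
    e₃ = solve-∀
    σ′ : Support (term y x n) s′ l
    σ′ = term-support (≼-bound y) (≼-bound x) n
      (<-shift⇒≤ bx<s+l (e₂ n (bound x) (bound y) (+ l)))
      (≤-shift⇒< (ℤ.≤-refl {bound y}) (e₃ n (bound y) (+ l)))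

  -- The elementary move `y′ = y + c T^j z`, from which all divisions below are composed. Written on
  -- coefficients, multiplication by the monomial is a mere shift of the index.
  _≈_⊹_·T^_·_ : Laurent → Laurent → F → ℤ → Laurent → Set
  y′ ≈ y ⊹ c ·T^ j · z = ∀ n → coeff y′ n ≡ coeff y n +F (c *F coeff z (n - j))

  *L-linearʳ : ∀ x {y′ y c j z} → y′ ≈ y ⊹ c ·T^ j · z → (x *L y′) ≈ (x *L y) ⊹ c ·T^ j · (x *L z)
  -- One range serves all three products: it starts at the least of their three lower ends and runs
  -- past `bound x`.
  *L-linearʳ x {y′} {y} {c} {j} {z} y′≈ n with <-within (bound x) ((n - bound y′) ⊓ (n - bound y) ⊓ (n - j - bound z))
  ... | l , bx<s+l = begin
    coeff (x *L y′) n ≡⟨ coeff-* x y′ n (σ y′ n (ℤ.≤-trans (ℤ.i⊓j≤i a b) (ℤ.i⊓j≤i (n - bound y′) (n - bound y)))) ⟩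
    ∑ s l (term x y′ n) ≡⟨ ∑-cong s l expand ⟩
    ∑ s l (λ i → term x y n i +F (c *F term x z (n - j) i)) ≡⟨ ∑-+ s l ⟩
    ∑ s l (term x y n) +F ∑ s l (λ i → c *F term x z (n - j) i) ≡⟨ cong (∑ s l (term x y n) +F_) (∑-* c s l) ⟩
    ∑ s l (term x y n) +F (c *F ∑ s l (term x z (n - j))) ≡⟨ cong₂ (λ u v → u +F (c *F v))
      (coeff-* x y n (σ y n (ℤ.≤-trans (ℤ.i⊓j≤i a b) (ℤ.i⊓j≤j (n - bound y′) (n - bound y)))))
      (coeff-* x z (n - j) (σ z (n - j) (ℤ.i⊓j≤j a b))) ⟨
    coeff (x *L y) n +F (c *F coeff (x *L z) (n - j)) ∎
    where
    open ≡-Reasoning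
    a = (n - bound y′) ⊓ (n - bound y)
    b = n - j - bound z
    s = a ⊓ b
    σ : ∀ u m → s ≤ m - bound u → Support (term x u m) s l
    σ u m s≤ = term-support (≼-bound x) (≼-bound u) m s≤ bx<s+l
    e : ∀ n i j → n - i - j ≡ n - j - i
    e = solve-∀
    expand : ∀ i → term x y′ n i ≡ term x y n i +F (c *F term x z (n - j) i)
    expand i = trans (cong (coeff x i *F_) (trans (y′≈ (n - i)) (cong (λ m → coeff y (n - i) +F (c *F coeff z m)) (e n i j))))
      (trans (distribˡ _ _ _) (cong (term x y n i +F_) (x*yz≡y*xz _ _ _)))

  *L-linearˡ : ∀ x {y′ y c j z} → y′ ≈ y ⊹ c ·T^ j · z → (y′ *L x) ≈ (y *L x) ⊹ c ·T^ j · (z *L x)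
  *L-linearˡ x {y′} {y} {c} {j} {z} y′≈ n = trans (*L-comm y′ x n) (trans (*L-linearʳ x {y′} {y} {c} {j} {z} y′≈ n)
    (cong₂ (λ u v → u +F (c *F v)) (*L-comm x y n) (*L-comm x z (n - j))))

  -- This is linearity for the move `y = z + 0 z`.
  *L-congʳ : ∀ x {y z} → y ≈L z → (x *L y) ≈L (x *L z)
  *L-congʳ x {y} {z} y≈z n = trans
    (*L-linearʳ x {y} {z} {0F} {+ 0} {z} (λ m → trans (y≈z m) (sym (drop m))) n)
    (trans (cong (coeff (x *L z) n +F_) (zeroˡ _)) (+-identityʳ _))
    where
    drop : ∀ m → coeff z m +F (0F *F coeff z (m - + 0)) ≡ coeff z m
    drop m = trans (cong (coeff z m +F_) (zeroˡ _)) (+-identityʳ _)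

  *L-congˡ : ∀ x {y z} → y ≈L z → (y *L x) ≈L (z *L x)
  *L-congˡ x {y} {z} y≈z n = trans (*L-comm y x n) (trans (*L-congʳ x {y} {z} y≈z n) (*L-comm x z n))

  *L-zeroʳ : ∀ x {y} → IsZero y → IsZero (x *L y)
  *L-zeroʳ x {y} y≡0 n = coeff-* x y n {+ 0} {0} ((λ i _ → vanishes i) , (λ i _ → vanishes i))
    where
    vanishes : ∀ i → term x y n i ≡ 0F
    vanishes i = trans (cong (coeff x i *F_) (y≡0 (n - i))) (zeroʳ _)

  *L-zeroˡ : ∀ x {y} → IsZero y → IsZero (y *L x)
  *L-zeroˡ x {y} y≡0 n = trans (*L-comm y x n) (*L-zeroʳ x {y} y≡0 n)

  -- Degrees and leading coefficients.

  ≼-pred : ∀ {x a} → x ≼ (a + + 1) → coeff x (a + + 1) ≡ 0F → x ≼ a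
  ≼-pred {x} {a} x≼a+1 top≡0 = deg≤ go
    where
    e : ∀ n a → n - a ≡ n - (a + + 1) + + 1
    e = solve-∀
    go : ∀ n → a < n → coeff x n ≡ 0F
    go n a<n with (a + + 1) ℤ.≟ n
    ... | yes refl = top≡0
    ... | no a+1≢n = above x≼a+1 n (ℤ.≤∧≢⇒< (<-shift⇒≤ a<n (e n a)) a+1≢n)

  HasDeg⇒≼ : ∀ {x d} → HasDeg x (just d) → x ≼ d
  HasDeg⇒≼ (_ , high) = deg≤ high

  HasDeg-≤ : ∀ {x d b} → HasDeg x (just d) → x ≼ b → d ≤ b
  HasDeg-≤ {d = d} {b} (top≢0 , _) x≼b with d ℤ.≤? b
  ... | yes d≤b = d≤b
  ... | no  d≰b = ⊥-elim (top≢0 (above x≼b d (ℤ.≰⇒> d≰b)))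

  HasDeg-unique : ∀ {x d d′} → HasDeg x (just d) → HasDeg x (just d′) → d ≡ d′
  HasDeg-unique {x} δ δ′ = ℤ.≤-antisym (HasDeg-≤ {x} δ (HasDeg⇒≼ {x} δ′)) (HasDeg-≤ {x} δ′ (HasDeg⇒≼ {x} δ))

  HasDeg-resp-≈ : ∀ {x y d} → x ≈L y → HasDeg x (just d) → HasDeg y (just d)
  HasDeg-resp-≈ x≈y (top≢0 , high) =
    (λ top≡0 → top≢0 (trans (x≈y _) top≡0)) , (λ m d<m → trans (sym (x≈y m)) (high m d<m))

  IsZero⇒¬HasDeg : ∀ {x d} → IsZero x → ¬ HasDeg x (just d)
  IsZero⇒¬HasDeg x≡0 (top≢0 , _) = top≢0 (x≡0 _)

  -- Excluded middle tells whether some coefficient is nonzero, a question about infinitely many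
  -- indices. Once one is known at `n`, the search descends from an upper bound `n + k` and stops at
  -- the first nonzero coefficient.
  degree : ExcludedMiddle 0ℓ → ∀ x → ¬ IsZero x → ∃ λ d → HasDeg x (just d)
  degree em x x≢0 with em {∃ λ n → coeff x n ≢ 0F}
  ... | no ∄ = ⊥-elim (x≢0 zeros)
    where
    zeros : ∀ n → coeff x n ≡ 0F
    zeros n with coeff x n ≟F 0F
    ... | yes ≡0 = ≡0
    ... | no  ≢0 = ⊥-elim (∄ (n , ≢0))
  ... | yes (n , ≢0) with ≤-within n (bound x)
  ...   | k , b≤n+k = search k (≼-weaken b≤n+k (≼-bound x))
    where
    e : ∀ n k → n + (+ 1 + k) ≡ n + k + + 1
    e = solve-∀
    search : ∀ k → x ≼ (n + + k) → ∃ λ d → HasDeg x (just d)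
    search zero x≼ = n , ≢0 , above (subst (x ≼_) (ℤ.+-identityʳ n) x≼)
    search (suc k) x≼ with coeff x (n + + suc k) ≟F 0F
    ... | no  top≢0 = n + + suc k , top≢0 , above x≼
    ... | yes top≡0 = search k (≼-pred (subst (x ≼_) (e n (+ k)) x≼) (subst (λ m → coeff x m ≡ 0F) (e n (+ k)) top≡0))

  nonzero-* : ∀ {a b} → a ≢ 0F → b ≢ 0F → a *F b ≢ 0F
  nonzero-* {a} {b} a≢0 b≢0 ab≡0 = b≢0 (begin
    b                          ≡⟨ *-identityˡ b ⟨
    1F *F b                    ≡⟨ cong (_*F b) (trans (*-comm _ _) (invF-correct a a≢0)) ⟨
    (invF a a≢0 *F a) *F b     ≡⟨ *-assoc _ _ _ ⟩
    invF a a≢0 *F (a *F b)     ≡⟨ cong (invF a a≢0 *F_) ab≡0 ⟩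
    invF a a≢0 *F 0F           ≡⟨ zeroʳ _ ⟩
    0F                         ∎)
    where open ≡-Reasoning

  HasDeg-* : ∀ {x y a b} → HasDeg x (just a) → HasDeg y (just b) → HasDeg (x *L y) (just (a + b))
  HasDeg-* {x} {y} δ ε =
    (λ top≡0 → nonzero-* (proj₁ δ) (proj₁ ε) (trans (sym (coeff-*-top x≼ y≼)) top≡0)) , above (≼-* x≼ y≼)
    where
    x≼ = HasDeg⇒≼ {x} δ
    y≼ = HasDeg⇒≼ {y} ε

  *L-nonzero : ExcludedMiddle 0ℓ → ∀ {x y} → ¬ IsZero x → IsZero (x *L y) → IsZero y
  *L-nonzero em {x} {y} x≢0 xy≡0 = cases em
    where
    cases : Dec (IsZero y) → IsZero y
    cases (yes y≡0) = y≡0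
    cases (no  y≢0) =
      let _ , δ = degree em x x≢0
          _ , ε = degree em y y≢0
      in ⊥-elim (IsZero⇒¬HasDeg {x *L y} xy≡0 (HasDeg-* {x} {y} δ ε))

  -- Division with remainder, one leading term at a time.

  ≼-⊹ : ∀ {x′ x c j y a b} → x′ ≈ x ⊹ c ·T^ j · y → x ≼ a → y ≼ b → b + j ≤ a → x′ ≼ a
  ≼-⊹ {x′} {x} {c} {j} {y} {a} {b} x′≈ x≼a y≼b b+j≤a = deg≤ λ n a<n → begin
    coeff x′ n                              ≡⟨ x′≈ n ⟩
    coeff x n +F (c *F coeff y (n - j))     ≡⟨ cong₂ (λ u v → u +F (c *F v)) (above x≼a n a<n)
                                                 (above y≼b (n - j) (<-shift (ℤ.≤-<-trans b+j≤a a<n) (e n b j))) ⟩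
    0F +F (c *F 0F)                         ≡⟨ trans (+-identityˡ _) (zeroʳ c) ⟩
    0F                                      ∎
    where
    open ≡-Reasoning
    e : ∀ n b j → n - (b + j) ≡ n - j - b
    e = solve-∀

  -- The scalar `c` for which `x + c T^j y` has no term of degree `d + j`.
  killer : ∀ x {y d} → HasDeg y (just d) → ℕ → F
  killer x {y} {d} (y≢0 , _) j = (-F coeff x (d + + j)) *F invF (coeff y d) y≢0

  -- Bounds have the form `d - 1 + j` so that `j` counts the leading terms still to be removed; at
  -- `j = 0` the degree is below that of `y`.
  ≼-kill : ∀ {x′ x y d j} (δ : HasDeg y (just d)) → x′ ≈ x ⊹ killer x {y} δ j ·T^ + j · y →
           x ≼ (d - + 1 + + suc j) → x′ ≼ (d - + 1 + + j)
  ≼-kill {x′} {x} {y} {d} {j} δ x′≈ x≼ =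
    ≼-pred (subst (x′ ≼_) (e₂ d (+ j)) x′≼) (trans (cong (coeff x′) (sym (e₂ d (+ j)))) top≡0)
    where
    open ≡-Reasoning
    e₁ : ∀ d j → d - + 1 + (+ 1 + j) ≡ d + j
    e₁ = solve-∀
    e₂ : ∀ d j → d + j ≡ d - + 1 + j + + 1
    e₂ = solve-∀
    e₃ : ∀ d j → d + j - j ≡ d
    e₃ = solve-∀
    x′≼ : x′ ≼ (d + + j)
    x′≼ = ≼-⊹ {x′} {x} {y = y} x′≈ (subst (x ≼_) (e₁ d (+ j)) x≼) (HasDeg⇒≼ {y} δ) ℤ.≤-refl
    t = coeff x (d + + j)
    top≡0 : coeff x′ (d + + j) ≡ 0F
    top≡0 = begin
      coeff x′ (d + + j)                                     ≡⟨ x′≈ (d + + j) ⟩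
      t +F (killer x {y} δ j *F coeff y (d + + j - + j))      ≡⟨ cong (λ m → t +F (killer x {y} δ j *F coeff y m)) (e₃ d (+ j)) ⟩
      t +F (((-F t) *F invF (coeff y d) (proj₁ δ)) *F coeff y d)
        ≡⟨ cong (t +F_) (trans (*-assoc _ _ _) (trans (cong ((-F t) *F_) (trans (*-comm _ _) (invF-correct _ _))) (*-identityʳ _))) ⟩
      t +F (-F t)                                            ≡⟨ -‿inverseʳ t ⟩
      0F                                                     ∎

  -- The type `P` of points stays abstract because the division is applied to lattice vectors with a
  -- proof attached as well as to bare ones, and with either coordinate in the role of `φ`.
  module Reduction {P : Set} (φ ψ : P → Laurent) {y z : Laurent} (act : P → F → ℕ → P)
    (act-φ : ∀ p c j → φ (act p c j) ≈ φ p ⊹ c ·T^ + j · y)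
    (act-ψ : ∀ p c j → ψ (act p c j) ≈ ψ p ⊹ c ·T^ + j · z) where

    -- The multiples of `y` that are added to `φ p` have monomials of degree at most `i - 1`. The
    -- same multiples of `z` change `ψ p` in degrees at most `C + i - 1`, which the hypothesis keeps
    -- within `E`.
    reduce : ∀ {d C E} → HasDeg y (just d) → z ≼ C → ∀ i p → C + + i ≤ E + + 1 →
             φ p ≼ (d - + 1 + + i) → ψ p ≼ E → ∃ λ p′ → φ p′ ≼ (d - + 1) × ψ p′ ≼ E
    reduce {d} δ z≼C zero p _ φp≼ ψp≼ = p , subst (φ p ≼_) (ℤ.+-identityʳ _) φp≼ , ψp≼
    reduce {d} {C} {E} δ z≼C (suc i) p C+i≤E φp≼ ψp≼ =
      reduce δ z≼C i p′ (ℤ.≤-trans C+i≤E′ (i≤i+n E 1))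
        (≼-kill {φ p′} {φ p} {y} δ (act-φ p c i) φp≼)
        (≼-⊹ {ψ p′} {ψ p} {y = z} (act-ψ p c i) ψp≼ z≼C C+i≤E′)
      where
      c = killer (φ p) {y} δ i
      p′ = act p c i
      e : ∀ C i E → E + + 1 - (C + (+ 1 + i)) ≡ E - (C + i)
      e = solve-∀
      C+i≤E′ : C + + i ≤ E
      C+i≤E′ = ≤-shift C+i≤E (e C (+ i) E)

  -- Polynomials as coefficient lists and as Laurent series.

  polyCoeff : Poly → ℤ → F
  polyCoeff p (+ n)    = coeffPoly p n
  polyCoeff p -[1+ n ] = 0F

  coeffPoly-len : ∀ p n → lenPoly p ℕ.≤ n → coeffPoly p n ≡ 0F
  coeffPoly-len []      n       _           = refl
  coeffPoly-len (a ∷ p) (suc n) (ℕ.s≤s len≤n) = coeffPoly-len p n len≤n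

  coeff-polyL : ∀ p n → coeff (polyL p) n ≡ polyCoeff p n
  coeff-polyL p (+ n) with + lenPoly p ℤ.<? + n
  ... | yes (+<+ len<n) = sym (coeffPoly-len p n (ℕ.<⇒≤ len<n))
  ... | no _ = refl
  coeff-polyL p -[1+ n ] = refl

  addPoly : Poly → Poly → Poly
  addPoly []      r       = r
  addPoly (a ∷ p) []      = a ∷ p
  addPoly (a ∷ p) (b ∷ r) = (a +F b) ∷ addPoly p r

  mulMonomial : F → ℕ → Poly → Poly
  mulMonomial c zero    p = map (c *F_) p
  mulMonomial c (suc j) p = 0F ∷ mulMonomial c j p

  coeffPoly-add : ∀ p r n → coeffPoly (addPoly p r) n ≡ coeffPoly p n +F coeffPoly r n
  coeffPoly-add []      r       n       = sym (+-identityˡ _)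
  coeffPoly-add (a ∷ p) []      n       = sym (+-identityʳ _)
  coeffPoly-add (a ∷ p) (b ∷ r) zero    = refl
  coeffPoly-add (a ∷ p) (b ∷ r) (suc n) = coeffPoly-add p r n

  polyCoeff-add : ∀ p r n → polyCoeff (addPoly p r) n ≡ polyCoeff p n +F polyCoeff r n
  polyCoeff-add p r (+ n)    = coeffPoly-add p r n
  polyCoeff-add p r -[1+ n ] = sym (+-identityˡ 0F)

  coeffPoly-map : ∀ c p n → coeffPoly (map (c *F_) p) n ≡ c *F coeffPoly p n
  coeffPoly-map c []      n       = sym (zeroʳ c)
  coeffPoly-map c (a ∷ p) zero    = refl
  coeffPoly-map c (a ∷ p) (suc n) = coeffPoly-map c p n

  polyCoeff-shift : ∀ p n → polyCoeff (0F ∷ p) n ≡ polyCoeff p (n - + 1)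
  polyCoeff-shift p (+ zero)    = refl
  polyCoeff-shift p (+ (suc n)) = refl
  polyCoeff-shift p -[1+ n ]    = refl

  polyCoeff-monomial : ∀ c j p n → polyCoeff (mulMonomial c j p) n ≡ c *F polyCoeff p (n - + j)
  polyCoeff-monomial c zero p (+ n)    = trans (coeffPoly-map c p n) (cong (λ m → c *F polyCoeff p m) (sym (ℤ.+-identityʳ (+ n))))
  polyCoeff-monomial c zero p -[1+ n ] = sym (zeroʳ c)
  polyCoeff-monomial c (suc j) p n = trans (polyCoeff-shift (mulMonomial c j p) n)
    (trans (polyCoeff-monomial c j p (n - + 1)) (cong (λ m → c *F polyCoeff p m) (e n (+ j))))
    where
    e : ∀ n j → n - + 1 - j ≡ n - (+ 1 + j)
    e = solve-∀

  addMonomialMultiple : Poly → F → ℕ → Poly → Poly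
  addMonomialMultiple p c j r = addPoly p (mulMonomial c j r)

  polyL-addMonomialMultiple : ∀ p c j r → polyL (addMonomialMultiple p c j r) ≈ polyL p ⊹ c ·T^ + j · polyL r
  polyL-addMonomialMultiple p c j r n = begin
    coeff (polyL (addMonomialMultiple p c j r)) n       ≡⟨ coeff-polyL (addMonomialMultiple p c j r) n ⟩
    polyCoeff (addMonomialMultiple p c j r) n           ≡⟨ polyCoeff-add p (mulMonomial c j r) n ⟩
    polyCoeff p n +F polyCoeff (mulMonomial c j r) n    ≡⟨ cong (polyCoeff p n +F_) (polyCoeff-monomial c j r n) ⟩
    polyCoeff p n +F (c *F polyCoeff r (n - + j))       ≡⟨ cong₂ (λ u v → u +F (c *F v)) (coeff-polyL p n) (coeff-polyL r (n - + j)) ⟨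
    coeff (polyL p) n +F (c *F coeff (polyL r) (n - + j)) ∎
    where open ≡-Reasoning

  *L-identityʳ : ∀ x → (x *L polyL (1F ∷ [])) ≈L x
  *L-identityʳ x n = begin
    coeff (x *L one) n                          ≡⟨ coeff-* x one n {n} {1} (left , right) ⟩
    (coeff x n *F coeff one (n - n)) +F 0F      ≡⟨ +-identityʳ _ ⟩
    coeff x n *F coeff one (n - n)              ≡⟨ cong (λ k → coeff x n *F coeff one k) (ℤ.+-inverseʳ n) ⟩
    coeff x n *F 1F                             ≡⟨ *-identityʳ _ ⟩
    coeff x n                                   ∎
    where
    open ≡-Reasoning
    one = polyL (1F ∷ [])
    -- The stored bound of a polynomial is its length, here 1, so the sharp bound 0 has to be shown
    -- separately.
    one≼0 : one ≼ + 0
    one≼0 = deg≤ λ { (+ zero) (+<+ ()) ; (+ (suc m)) _ → coeff-polyL (1F ∷ []) (+ suc m) }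
    left : ∀ i → i < n → term x one n i ≡ 0F
    left i i<n = term-left x one≼0 n i (ℤ.<-≤-trans i<n (ℤ.≤-reflexive (sym (ℤ.+-identityʳ n))))
    negative : ∀ k → k < + 0 → coeff one k ≡ 0F
    negative -[1+ k ] _ = refl
    negative (+ k) (+<+ ())
    e : ∀ n i → i - (n + + 1) + + 1 ≡ + 0 - (n - i)
    e = solve-∀
    right : ∀ i → n + + 1 ≤ i → term x one n i ≡ 0F
    right i n<i = trans (cong (coeff x i *F_) (negative (n - i) (≤-shift⇒< n<i (e n i)))) (zeroʳ _)

  polyL-[]-zero : IsZero (polyL [])
  polyL-[]-zero (+ n) = coeff-polyL [] (+ n)
  polyL-[]-zero -[1+ n ] = refl

  -- Linear forms evaluated at pairs of polynomials.

  form : Laurent → Laurent → Poly × Poly → Laurent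
  form l k Q = (l *L polyL (proj₁ Q)) +L (k *L polyL (proj₂ Q))

  -- The vector `v + c T^j w`; the direction `w` comes first.
  translate : Poly × Poly → Poly × Poly → F → ℕ → Poly × Poly
  translate w v c j =
    addMonomialMultiple (proj₁ v) c j (proj₁ w) , addMonomialMultiple (proj₂ v) c j (proj₂ w)

  ⊹-+ : ∀ {x′ x y′ y c j u v} → x′ ≈ x ⊹ c ·T^ j · u → y′ ≈ y ⊹ c ·T^ j · v → (x′ +L y′) ≈ (x +L y) ⊹ c ·T^ j · (u +L v)
  ⊹-+ {x′} {x} {y′} {y} {c} {j} {u} {v} x′≈ y′≈ n = begin
    coeff (x′ +L y′) n ≡⟨ coeff-+ x′ y′ n ⟩
    coeff x′ n +F coeff y′ n ≡⟨ cong₂ _+F_ (x′≈ n) (y′≈ n) ⟩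
    (coeff x n +F (c *F coeff u (n - j))) +F (coeff y n +F (c *F coeff v (n - j))) ≡⟨ +-interchange _ _ _ _ ⟩
    (coeff x n +F coeff y n) +F ((c *F coeff u (n - j)) +F (c *F coeff v (n - j))) ≡⟨ cong (_ +F_) (distribˡ _ _ _) ⟨
    (coeff x n +F coeff y n) +F (c *F (coeff u (n - j) +F coeff v (n - j)))
      ≡⟨ cong₂ (λ a b → a +F (c *F b)) (coeff-+ x y n) (coeff-+ u v (n - j)) ⟨
    coeff (x +L y) n +F (c *F coeff (u +L v) (n - j)) ∎
    where open ≡-Reasoning

  form-translate : ∀ l k w v c j → form l k (translate w v c j) ≈ form l k v ⊹ c ·T^ + j · form l k w
  form-translate l k (a , b) (a′ , b′) c j = ⊹-+
    {l *L polyL (addMonomialMultiple a′ c j a)} {l *L polyL a′} {k *L polyL (addMonomialMultiple b′ c j b)} {k *L polyL b′}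
    {u = l *L polyL a} {k *L polyL b}
    (*L-linearʳ l {polyL (addMonomialMultiple a′ c j a)} {polyL a′} {z = polyL a} (polyL-addMonomialMultiple a′ c j a))
    (*L-linearʳ k {polyL (addMonomialMultiple b′ c j b)} {polyL b′} {z = polyL b} (polyL-addMonomialMultiple b′ c j b))

  affine-translate : ∀ l k r w v c j → (form l k (translate w v c j) +L r) ≈ (form l k v +L r) ⊹ c ·T^ + j · form l k w
  affine-translate l k r w v c j n = begin
    coeff (form l k (translate w v c j) +L r) n ≡⟨ coeff-+ (form l k (translate w v c j)) r n ⟩
    coeff (form l k (translate w v c j)) n +F coeff r n ≡⟨ cong (_+F coeff r n) (form-translate l k w v c j n) ⟩
    (coeff (form l k v) n +F t) +F coeff r n ≡⟨ +-swapʳ _ _ _ ⟩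
    (coeff (form l k v) n +F coeff r n) +F t ≡⟨ cong (_+F t) (coeff-+ (form l k v) r n) ⟨
    coeff (form l k v +L r) n +F t ∎
    where
    open ≡-Reasoning
    t = c *F coeff (form l k w) (n - + j)

  e₁ e₂ : Poly × Poly
  e₁ = (1F ∷ []) , []
  e₂ = [] , (1F ∷ [])

  form-e₁ : ∀ l k → form l k e₁ ≈L l
  form-e₁ l k n = trans (coeff-+ (l *L polyL (1F ∷ [])) (k *L polyL []) n)
    (trans (cong₂ _+F_ (*L-identityʳ l n) (*L-zeroʳ k {polyL []} polyL-[]-zero n)) (+-identityʳ _))

  form-e₂ : ∀ l k → form l k e₂ ≈L k
  form-e₂ l k n = trans (coeff-+ (l *L polyL []) (k *L polyL (1F ∷ [])) n)
    (trans (cong₂ _+F_ (*L-zeroʳ l {polyL []} polyL-[]-zero n) (*L-identityʳ k n)) (+-identityˡ _))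

  -- Determinants of pairs of lattice vectors.

  module Lattice {V : Set} (f g : V → Laurent) (translate : V → V → F → ℕ → V)
    (f-translate : ∀ w v c j → f (translate w v c j) ≈ f v ⊹ c ·T^ + j · f w)
    (g-translate : ∀ w v c j → g (translate w v c j) ≈ g v ⊹ c ·T^ + j · g w) where

    opaque
      -- Opaque, so that everything after `coeff-det` depends on that formula alone.
      det : V → V → Laurent
      det v w = (f v *L g w) -L (g v *L f w)

      coeff-det : ∀ v w n → coeff (det v w) n ≡ coeff (f v *L g w) n +F (-F coeff (g v *L f w) n)
      coeff-det v w n = coeff-sub (f v *L g w) (g v *L f w) n

    -- Both products in the determinant grow by the same series `c T^j (f w)(g w)`, which cancels in
    -- the difference.
    det-translate : ∀ w v c j → det (translate w v c j) w ≈L det v w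
    det-translate w v c j n = begin
      coeff (det v′ w) n ≡⟨ coeff-det v′ w n ⟩
      coeff (f v′ *L g w) n +F (-F coeff (g v′ *L f w) n)
        ≡⟨ cong₂ (λ a b → a +F (-F b))
             (*L-linearˡ (g w) {f v′} {f v} {z = f w} (f-translate w v c j) n)
             (trans (*L-linearˡ (f w) {g v′} {g v} {z = g w} (g-translate w v c j) n)
               (cong (λ a → coeff (g v *L f w) n +F (c *F a)) (*L-comm (g w) (f w) (n - + j)))) ⟩
      (coeff (f v *L g w) n +F t) +F (-F (coeff (g v *L f w) n +F t)) ≡⟨ cancel _ _ t ⟩
      coeff (f v *L g w) n +F (-F coeff (g v *L f w) n) ≡⟨ coeff-det v w n ⟨
      coeff (det v w) n ∎
      where
      open ≡-Reasoning
      v′ = translate w v c j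
      t = c *F coeff (f w *L g w) (n - + j)
      cancel : ∀ a b t → (a +F t) +F (-F (b +F t)) ≡ a +F (-F b)
      cancel a b t = trans (cong ((a +F t) +F_) (sym (-‿+-comm b t)))
        (trans (+-interchange a t (-F b) (-F t)) (trans (cong ((a +F (-F b)) +F_) (-‿inverseʳ t)) (+-identityʳ _)))

    det-swap : ∀ v w n → coeff (det w v) n ≡ -F coeff (det v w) n
    det-swap v w n = begin
      coeff (det w v) n ≡⟨ coeff-det w v n ⟩
      coeff (f w *L g v) n +F (-F coeff (g w *L f v) n)
        ≡⟨ cong₂ (λ a b → a +F (-F b)) (*L-comm (f w) (g v) n) (*L-comm (g w) (f v) n) ⟩
      b +F (-F a) ≡⟨ trans (cong (_+F (-F a)) (sym (-‿involutive b))) (trans (-‿+-comm _ _) (cong -F_ (+-comm _ _))) ⟩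
      -F (a +F (-F b)) ≡⟨ cong -F_ (coeff-det v w n) ⟨
      -F coeff (det v w) n ∎
      where
      open ≡-Reasoning
      a = coeff (f v *L g w) n
      b = coeff (g v *L f w) n

    det-≈ : ∀ v w → IsZero (f w) → det v w ≈L (f v *L g w)
    det-≈ v w fw≡0 n = trans (coeff-det v w n)
      (trans (cong (λ b → coeff (f v *L g w) n +F (-F b)) (*L-zeroʳ (g v) {f w} fw≡0 n))
        (trans (cong (coeff (f v *L g w) n +F_) -0#≈0#) (+-identityʳ _)))

    det-≼ : ∀ {v w a b} → f v ≼ a → f w ≼ a → g v ≼ b → g w ≼ b → det v w ≼ (a + b)
    det-≼ {v} {w} {a} {b} fv fw gv gw = deg≤ λ n a+b<n → trans (coeff-det v w n)
      (trans (cong₂ (λ s t → s +F (-F t)) (above (≼-* fv gw) n a+b<n)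
                (above (≼-* gv fw) n (subst (_< n) (ℤ.+-comm a b) a+b<n)))
        (-‿inverseʳ 0F))

    -- The product of `g v` and `f w` has degree at most `d + b - 1`, so it cannot reach the top
    -- coefficient. The formula ties the degree of the determinant to the coefficient of `g w` in
    -- degree `b`.
    det-top : ∀ {v w d b} → f v ≼ d → f w ≼ (d - + 1) → g v ≼ b → g w ≼ b →
              coeff (det v w) (d + b) ≡ coeff (f v) d *F coeff (g w) b
    det-top {v} {w} {d} {b} fv fw gv gw = begin
      coeff (det v w) (d + b)
        ≡⟨ coeff-det v w (d + b) ⟩
      coeff (f v *L g w) (d + b) +F (-F coeff (g v *L f w) (d + b))
        ≡⟨ cong₂ (λ s t → s +F (-F t)) (coeff-*-top fv gw) (above (≼-* gv fw) (d + b) (≤-shift⇒< (ℤ.≤-refl {b}) (e d b))) ⟩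
      (coeff (f v) d *F coeff (g w) b) +F (-F 0F)
        ≡⟨ trans (cong ((coeff (f v) d *F coeff (g w) b) +F_) -0#≈0#) (+-identityʳ _) ⟩
      coeff (f v) d *F coeff (g w) b ∎
      where
      open ≡-Reasoning
      e : ∀ d b → b - b + + 1 ≡ d + b - (b + (d - + 1))
      e = solve-∀

    -- Euclid's algorithm on bases of the lattice.

    module Euclid (em : ExcludedMiddle 0ℓ) (e : ℤ) where

      -- A basis is represented by what translations and swaps preserve, the degree `e` of its
      -- determinant.
      record Basis (v w : V) : Set where
        constructor basis
        field deg-det : HasDeg (det v w) (just e)
      open Basis public

      Basis-swap : ∀ {v w} → Basis v w → Basis w v
      Basis-swap {v} {w} (basis (top≢0 , high)) = basis (
        (λ top≡0 → top≢0 (neg≡0 (trans (sym (det-swap v w e)) top≡0))) ,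
        (λ m e<m → trans (det-swap v w m) (trans (cong -F_ (high m e<m)) -0#≈0#)))
        where
        neg≡0 : ∀ {a} → -F a ≡ 0F → a ≡ 0F
        neg≡0 {a} -a≡0 = trans (sym (-‿involutive a)) (trans (cong -F_ -a≡0) -0#≈0#)

      Basis-translate : ∀ {w} → ∃ (λ v → Basis v w) → F → ℕ → ∃ (λ v → Basis v w)
      Basis-translate {w} (v , basis δ) c j = translate w v c j ,
        basis (HasDeg-resp-≈ {det v w} {det (translate w v c j) w} (λ n → sym (det-translate w v c j n)) δ)

      -- The division runs on vectors paired with a proof that they form a basis with `w`, so the
      -- remainder arrives with such a proof.
      Basis-reduce : ∀ {v w d C E} i → Basis v w → HasDeg (f w) (just d) → g w ≼ C → C + + i ≤ E + + 1 →
                     f v ≼ (d - + 1 + + i) → g v ≼ E → ∃ λ v′ → Basis v′ w × f v′ ≼ (d - + 1) × g v′ ≼ E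
      Basis-reduce {v} {w} {d} {C} {E} i β δ gw C+i≤E fv gv = proj₁ (proj₁ r) , proj₂ (proj₁ r) , proj₂ r
        where
        P = ∃ λ v → Basis v w
        act-f : ∀ (p : P) c j → f (proj₁ (Basis-translate p c j)) ≈ f (proj₁ p) ⊹ c ·T^ + j · f w
        act-f p = f-translate w (proj₁ p)
        act-g : ∀ (p : P) c j → g (proj₁ (Basis-translate p c j)) ≈ g (proj₁ p) ⊹ c ·T^ + j · g w
        act-g p = g-translate w (proj₁ p)
        module R = Reduction {P} (λ p → f (proj₁ p)) (λ p → g (proj₁ p)) {f w} {g w} Basis-translate act-f act-g
        r : ∃ λ (p : P) → f (proj₁ p) ≼ (d - + 1) × g (proj₁ p) ≼ E
        r = R.reduce {d} {C} {E} δ gw i (v , β) C+i≤E fv gv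

      -- The state after one division: `w` has moved to the first place, with degree `d′`, and the
      -- remainder `v′` is second. The index `s` prescribes the new sum of the two bounds.
      record Successor (w : V) (d s : ℤ) : Set where
        constructor successor
        field
          {v′}     : V
          {d′ E}   : ℤ
          swapped  : Basis w v′
          decrease : d′ ≤ d - + 1
          total    : d′ + E ≡ s
          deg-fw   : HasDeg (f w) (just d′)
          fv′≼     : f v′ ≼ (d′ - + 1)
          gw≼      : g w ≼ E
          gv′≼     : g v′ ≼ E

      -- The quotient has degree `d - d′ = t + 1`, so the second coordinates are bounded by
      -- `C + t + 1` afterwards. The second bound exceeds `C` by exactly what the first loses, and
      -- the sum is `d + C`.
      successor-at : ∀ {v w d C} d′ t → Basis v w → HasDeg (f v) (just d) → g v ≼ (C + + 1) → g w ≼ C →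
                     HasDeg (f w) (just d′) → d - + 1 ≡ d′ + + t → Successor w d (d + C)
      successor-at {v} {w} {d} {C} d′ t β δ gv gw δ′ d-1≡d′+t = assemble
        -- The terms of degrees `d′` to `d` are removed, and there are `t + 2` of them.
        (Basis-reduce {v} {w} {d′} {C} {C + + suc t} (suc (suc t)) β δ′ gw (ℤ.≤-reflexive (eq₁ C (+ t)))
          (subst (f v ≼_) d≡ (HasDeg⇒≼ {f v} δ)) (≼-weaken C+1≤ gv))
        where
        eq₁ : ∀ C t → C + (+ 1 + (+ 1 + t)) ≡ C + (+ 1 + t) + + 1
        eq₁ = solve-∀
        eq₂ : ∀ d → d ≡ d - + 1 + + 1
        eq₂ = solve-∀
        eq₃ : ∀ d′ t → d′ + t + + 1 ≡ d′ - + 1 + (+ 1 + (+ 1 + t))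
        eq₃ = solve-∀
        d≡ : d ≡ d′ - + 1 + + suc (suc t)
        d≡ = trans (eq₂ d) (trans (cong (_+ + 1) d-1≡d′+t) (eq₃ d′ (+ t)))
        C+1≤ : C + + 1 ≤ C + + suc t
        C+1≤ = ℤ.+-monoʳ-≤ C (+≤+ (ℕ.s≤s ℕ.z≤n))
        eq₄ : ∀ d′ C t → d′ + (C + (+ 1 + t)) ≡ d′ + t + + 1 + C
        eq₄ = solve-∀
        eq₅ : ∀ d C → d - + 1 + + 1 + C ≡ d + C
        eq₅ = solve-∀
        sum≡ : d′ + (C + + suc t) ≡ d + C
        sum≡ = trans (eq₄ d′ C (+ t)) (trans (cong (λ x → x + + 1 + C) (sym d-1≡d′+t)) (eq₅ d C))
        assemble : (∃ λ v′ → Basis v′ w × f v′ ≼ (d′ - + 1) × g v′ ≼ (C + + suc t)) → Successor w d (d + C)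
        assemble (v′ , β′ , fv′ , gv′) = successor {v′ = v′} {d′} {C + + suc t} (Basis-swap β′)
          (ℤ.≤-trans (i≤i+n d′ t) (ℤ.≤-reflexive (sym d-1≡d′+t))) sum≡ δ′ fv′ (≼-weaken (i≤i+n C (suc t)) gw) gv′

      -- The bound on `g v` is one weaker than that on `g w`, so that one lemma serves both phases:
      -- `C = B - 1` lowers the sum of the bounds, `C = B` keeps it.
      step : ∀ {v w d C} → Basis v w → HasDeg (f v) (just d) → f w ≼ (d - + 1) → g v ≼ (C + + 1) → g w ≼ C →
             IsZero (f w) ⊎ Successor w d (d + C)
      step {v} {w} {d} {C} β δ fw gv gw = cases em
        where
        cases : Dec (IsZero (f w)) → IsZero (f w) ⊎ Successor w d (d + C)
        cases (yes fw≡0) = inj₁ fw≡0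
        cases (no  fw≢0) =
          let d′ , δ′ = degree em (f w) fw≢0
              t , d-1≡d′+t = ≤-gap (HasDeg-≤ {f w} δ′ fw)
          in inj₂ (successor-at {v} {w} {d} {C} d′ t β δ gv gw δ′ d-1≡d′+t)

      data Outcome (N : ℤ) : Set where
        reduced    : ∀ v w d B → Basis v w → d ≤ N → d + B ≡ e → HasDeg (f v) (just d) → f w ≼ (d - + 1) →
                     g v ≼ B → g w ≼ B → Outcome N
        degenerate : ∀ v w → Basis v w → IsZero (f w) → Outcome N

      -- The determinant has no term of degree `d + B`, as this exceeds `e`. By `det-top` that
      -- coefficient is the leading coefficient of `f v` times the coefficient of `g w` in degree
      -- `B`, so the latter is zero.
      det-excess : ∀ {v w d B ε} → Basis v w → d + B ≡ e + + suc ε → HasDeg (f v) (just d) →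
                   f w ≼ (d - + 1) → g v ≼ B → g w ≼ B → g w ≼ (B - + 1)
      det-excess {v} {w} {d} {B} {ε} β d+B≡ δ fw gv gw =
        ≼-pred (subst (g w ≼_) (eq₁ B) gw) (trans (cong (coeff (g w)) (sym (eq₁ B))) (top≡0 (coeff (g w) B ≟F 0F)))
        where
        eq₁ : ∀ B → B ≡ B - + 1 + + 1
        eq₁ = solve-∀
        eq₂ : ∀ e ε → e + ε - e + + 1 ≡ e + (+ 1 + ε) - e
        eq₂ = solve-∀
        e<d+B : e < d + B
        e<d+B = subst (e <_) (sym d+B≡) (≤-shift⇒< (i≤i+n e ε) (eq₂ e (+ ε)))
        top≡0 : Dec (coeff (g w) B ≡ 0F) → coeff (g w) B ≡ 0F
        top≡0 (yes ≡0) = ≡0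
        top≡0 (no  ≢0) = ⊥-elim (nonzero-* (proj₁ δ) ≢0
          (trans (sym (det-top {v} {w} (HasDeg⇒≼ {f v} δ) fw gv gw)) (proj₂ (deg-det β) (d + B) e<d+B)))

      -- Here `ε` is the excess of `d + B` over `e`, and `n` bounds the distance of `d` from the
      -- target `N`. Each division lowers `ε` while it is positive and `n` from then on, which gives
      -- termination.
      run : ∀ N ε n v w d B → Basis v w → d + B ≡ e + + ε → d ≤ N + + n → HasDeg (f v) (just d) →
            f w ≼ (d - + 1) → g v ≼ B → g w ≼ B → Outcome N
      run N zero zero v w d B β d+B≡ d≤N δ fw gv gw =
        reduced v w d B β (subst (d ≤_) (ℤ.+-identityʳ N) d≤N) (trans d+B≡ (ℤ.+-identityʳ e)) δ fw gv gw
      run N zero (suc n) v w d B β d+B≡ d≤N δ fw gv gw =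
        continue (step {v} {w} {d} {B} β δ fw (≼-weaken (i≤i+n B 1) gv) gw)
        where
        eq : ∀ d N n → N + (+ 1 + n) - d ≡ N + n - (d - + 1)
        eq = solve-∀
        continue : IsZero (f w) ⊎ Successor w d (d + B) → Outcome N
        continue (inj₁ fw≡0) = degenerate v w β fw≡0
        continue (inj₂ (successor {v′} {d′} {E} β′ d′≤d-1 total δ′ fv′ gw′ gv′)) =
          run N zero n w v′ d′ E β′ (trans total d+B≡)
            (ℤ.≤-trans d′≤d-1 (≤-shift d≤N (eq d N (+ n)))) δ′ fv′ gw′ gv′
      run N (suc ε) n v w d B β d+B≡ d≤N δ fw gv gw =
        continue (step {v} {w} {d} {B - + 1} β δ fw (subst (g v ≼_) (eq₁ B) gv) (det-excess {ε = ε} β d+B≡ δ fw gv gw))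
        where
        eq₁ : ∀ B → B ≡ B - + 1 + + 1
        eq₁ = solve-∀
        eq₂ : ∀ d B → d + (B - + 1) ≡ d + B - + 1
        eq₂ = solve-∀
        eq₃ : ∀ e ε → e + (+ 1 + ε) - + 1 ≡ e + ε
        eq₃ = solve-∀
        continue : IsZero (f w) ⊎ Successor w d (d + (B - + 1)) → Outcome N
        continue (inj₁ fw≡0) = degenerate v w β fw≡0
        continue (inj₂ (successor {v′} {d′} {E} β′ d′≤d-1 total δ′ fv′ gw′ gv′)) =
          run N ε n w v′ d′ E β′
            (trans total (trans (eq₂ d B) (trans (cong (_- + 1) d+B≡) (eq₃ e (+ ε)))))
            (ℤ.≤-trans d′≤d-1 (ℤ.≤-trans (ℤ.i-j≤i d (+ 1)) d≤N)) δ′ fv′ gw′ gv′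

      -- One division of `v` by `w`, with generous bounds on the second coordinates, produces the
      -- invariants of `run`.
      start : ∀ N v w → Basis v w → Outcome N
      start N v w β = cases em
        where
        nonzero : ¬ IsZero (f w) → Outcome N
        nonzero fw≢0 =
          let d , δ          = degree em (f w) fw≢0
              i , fv≤        = ≤-within (d - + 1) (bound (f v))
              C              = bound (g w)
              E              = bound (g v) ⊔ (C + + i)
              gw≼E           = ≼-weaken (ℤ.≤-trans (i≤i+n C i) (ℤ.i≤j⊔i (bound (g v)) (C + + i))) (≼-bound (g w))
              v′ , β′ , fv′ , gv′ = Basis-reduce {v} {w} {d} {C} {E} i β δ (≼-bound (g w))
                (ℤ.≤-trans (ℤ.i≤j⊔i (bound (g v)) (C + + i)) (i≤i+n E 1))
                (≼-weaken fv≤ (≼-bound (f v))) (≼-weaken (ℤ.i≤i⊔j (bound (g v)) (C + + i)) (≼-bound (g v)))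
              fw≼ = HasDeg⇒≼ {f w} δ
              -- The excess is nonnegative because the determinant has degree `e` and all its terms
              -- have degree at most `d + E`.
              ε , d+E≡ = ≤-gap (HasDeg-≤ {det w v′} (deg-det (Basis-swap β′))
                (det-≼ {w} {v′} fw≼ (≼-weaken (ℤ.i-j≤i d (+ 1)) fv′) gw≼E gv′))
              n , d≤N+n = ≤-within N d
          in run N ε n w v′ d E (Basis-swap β′) d+E≡ d≤N+n δ fv′ gw≼E gv′
        cases : Dec (IsZero (f w)) → Outcome N
        cases (yes fw≡0) = degenerate v w β fw≡0
        cases (no  fw≢0) = nonzero fw≢0

      -- Moving an affine point into a small box.

      module Affine (X Y : V → Laurent)
        (X-translate : ∀ w v c j → X (translate w v c j) ≈ X v ⊹ c ·T^ + j · f w)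
        (Y-translate : ∀ w v c j → Y (translate w v c j) ≈ Y v ⊹ c ·T^ + j · g w) where

        -- Both bounds are strict, so the degrees add up to at most `a + b - 2`. This is the source
        -- of the factor `q^(-2)`.
        Small : ℤ → ℤ → Set
        Small a b = ∃ λ Q → X Q ≼ (a - + 1) × Y Q ≼ (b - + 1)

        -- In each round a multiple of `v` removes the top term of `X` and disturbs `Y` only up to
        -- its present bound. A multiple of `w` then removes the top term of `Y`; since `f w` has
        -- degree below `d`, it respects the bound just gained for `X`.
        small-box : ∀ {v w d B} → HasDeg (f v) (just d) → f w ≼ (d - + 1) → g v ≼ B → HasDeg (g w) (just B) →
                    ∀ i Q → X Q ≼ (d - + 1 + + i) → Y Q ≼ (B - + 1 + + i) → Small d B
        small-box {v} {w} {d} {B} δ fw gv γ zero Q XQ YQ =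
          Q , subst (X Q ≼_) (ℤ.+-identityʳ _) XQ , subst (Y Q ≼_) (ℤ.+-identityʳ _) YQ
        small-box {v} {w} {d} {B} δ fw gv γ (suc i) Q XQ YQ =
          small-box {v} {w} {d} {B} δ fw gv γ i Q₂
            (≼-⊹ {X Q₂} {X Q₁} {y = f w} (X-translate w Q₁ c₂ i) XQ₁ fw ℤ.≤-refl)
            (≼-kill {Y Q₂} {Y Q₁} {g w} γ (Y-translate w Q₁ c₂ i) YQ₁)
          where
          c₁ = killer (X Q) {f v} δ i
          Q₁ = translate v Q c₁ i
          eq : ∀ B i → B + i ≡ B - + 1 + (+ 1 + i)
          eq = solve-∀
          XQ₁ : X Q₁ ≼ (d - + 1 + + i)
          XQ₁ = ≼-kill {X Q₁} {X Q} {f v} δ (X-translate v Q c₁ i) XQ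
          YQ₁ : Y Q₁ ≼ (B - + 1 + + suc i)
          YQ₁ = ≼-⊹ {Y Q₁} {Y Q} {y = g v} (Y-translate v Q c₁ i) YQ gv (ℤ.≤-reflexive (eq B (+ i)))
          c₂ = killer (Y Q₁) {g w} γ i
          Q₂ = translate w Q₁ c₂ i

        small-reduced : ∀ {v w d B} → V → Basis v w → d + B ≡ e → HasDeg (f v) (just d) → f w ≼ (d - + 1) →
                        g v ≼ B → g w ≼ B → Small d B
        small-reduced {v} {w} {d} {B} Q β d+B≡e δ fw gv gw =
          let i , X≤ = ≤-within (d - + 1) (bound (X Q))
              j , Y≤ = ≤-within (B - + 1) (bound (Y Q))
          -- The two bounds must descend together, so both start from the common height `i + j`.
          in small-box {v} {w} {d} {B} δ fw gv (top≢0 , above gw) (i ℕ.+ j) Q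
               (≼-weaken (ℤ.≤-trans X≤ (ℤ.+-monoʳ-≤ (d - + 1) (+≤+ (ℕ.m≤m+n i j)))) (≼-bound (X Q)))
               (≼-weaken (ℤ.≤-trans Y≤ (ℤ.+-monoʳ-≤ (B - + 1) (+≤+ (ℕ.m≤n+m j i)))) (≼-bound (Y Q)))
          where
          -- If it vanished, `det-top` would make the coefficient of the determinant in degree
          -- `d + B = e` vanish too.
          top≢0 : coeff (g w) B ≢ 0F
          top≢0 ≡0 = proj₁ (deg-det β) (trans (cong (coeff (det v w)) (sym d+B≡e))
            (trans (det-top {v} {w} (HasDeg⇒≼ {f v} δ) fw gv gw) (trans (cong (coeff (f v) d *F_) ≡0) (zeroʳ _))))

        -- With `f w` zero the determinant is the product of `f v` and `g w`, so their degrees `a`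
        -- and `b` add up to `e`. Translations by `w` leave `X` fixed, hence `X` is reduced by `v`
        -- first and `Y` by `w` afterwards.
        small-degenerate : ∀ {v w} → V → Basis v w → IsZero (f w) → ∃ λ a → ∃ λ b → a + b ≡ e × Small a b
        small-degenerate {v} {w} Q β fw≡0 =
          let a , α = degree em (f v) λ fv≡0 → IsZero⇒¬HasDeg {det v w}
                        (λ n → trans (det-≈ v w fw≡0 n) (*L-zeroˡ (g w) {f v} fv≡0 n)) (deg-det β)
              b , γ = degree em (g w) λ gw≡0 → IsZero⇒¬HasDeg {det v w}
                        (λ n → trans (det-≈ v w fw≡0 n) (*L-zeroʳ (f v) {g w} gw≡0 n)) (deg-det β)
              i , X≤ = ≤-within (a - + 1) (bound (X Q))
              E = bound (Y Q) ⊔ (bound (g v) + + i)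
              Q₁ , XQ₁ , _ = V.reduce v {a} {bound (g v)} {E} α (≼-bound (g v)) i Q
                (ℤ.≤-trans (ℤ.i≤j⊔i (bound (Y Q)) (bound (g v) + + i)) (i≤i+n E 1))
                (≼-weaken X≤ (≼-bound (X Q))) (≼-weaken (ℤ.i≤i⊔j (bound (Y Q)) (bound (g v) + + i)) (≼-bound (Y Q)))
              j , Y≤ = ≤-within (b - + 1) (bound (Y Q₁))
              -- As `f w` is zero, every number bounds its degree; `a - j` is the one that keeps `X`
              -- within `a - 1` for `j` rounds.
              Q₂ , YQ₂ , XQ₂ = W.reduce w {b} {a - + j} {a - + 1} γ (deg≤ λ n _ → fw≡0 n) j Q₁
                (ℤ.≤-reflexive (eq a (+ j))) (≼-weaken Y≤ (≼-bound (Y Q₁))) XQ₁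
          in a , b ,
             HasDeg-unique {det v w}
               (HasDeg-resp-≈ {f v *L g w} {det v w} (λ n → sym (det-≈ v w fw≡0 n)) (HasDeg-* {f v} {g w} α γ))
               (deg-det β) ,
             Q₂ , XQ₂ , YQ₂
          where
          eq : ∀ a j → a - j + j ≡ a - + 1 + + 1
          eq = solve-∀
          module V (u : V) = Reduction X Y {f u} {g u} (translate u) (X-translate u) (Y-translate u)
          module W (u : V) = Reduction Y X {g u} {f u} (translate u) (Y-translate u) (X-translate u)

  -- The lattice of two given linear forms, and rationality.

  module Forms (l₁ k₁ l₂ k₂ : Laurent) where
    open Lattice (form l₁ k₁) (form l₂ k₂) translate (form-translate l₁ k₁) (form-translate l₂ k₂) public

    -- This makes the unit vectors a basis from which the algorithm can start.
    det-e₁-e₂ : ((l₁ *L k₂) -L (l₂ *L k₁)) ≈L det e₁ e₂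
    det-e₁-e₂ n = begin
      coeff ((l₁ *L k₂) -L (l₂ *L k₁)) n
        ≡⟨ coeff-sub (l₁ *L k₂) (l₂ *L k₁) n ⟩
      coeff (l₁ *L k₂) n +F (-F coeff (l₂ *L k₁) n)
        ≡⟨ cong₂ (λ a b → a +F (-F b)) (product l₁ k₁ l₂ k₂) (product l₂ k₂ l₁ k₁) ⟨
      coeff (form l₁ k₁ e₁ *L form l₂ k₂ e₂) n +F (-F coeff (form l₂ k₂ e₁ *L form l₁ k₁ e₂) n)
        ≡⟨ coeff-det e₁ e₂ n ⟨
      coeff (det e₁ e₂) n ∎
      where
      open ≡-Reasoning
      product : ∀ l k l′ k′ → coeff (form l k e₁ *L form l′ k′ e₂) n ≡ coeff (l *L k′) n
      product l k l′ k′ = trans (*L-congˡ (form l′ k′ e₂) {form l k e₁} {l} (form-e₁ l k) n)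
        (*L-congʳ l {form l′ k′ e₂} {k′} (form-e₂ l′ k′) n)

    det-zeroʳ : ∀ v w → IsZero (form l₁ k₁ w) → IsZero (form l₂ k₂ w) → IsZero (det v w)
    det-zeroʳ v w fw≡0 gw≡0 n = trans (det-≈ v w fw≡0 n) (*L-zeroʳ (form l₁ k₁ v) {form l₂ k₂ w} gw≡0 n)

    -- From `l₁ a + k₁ b = 0` the quotient is `-a / b`. If `b` were zero, `l₁ a = 0` would force `a`
    -- to be zero, both forms would vanish at `(a , b)`, and so would the determinant.
    degenerate⇒rational : ExcludedMiddle 0ℓ → ∀ {v w} → ¬ IsZero (det v w) → IsZero (form l₁ k₁ w) → ¬ IsZero l₁ →
                          QuotientRational k₁ l₁
    degenerate⇒rational em {v} {a , b} det≢0 fw≡0 l≢0 = a⁻ , b , b≢0 , eq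
      where
      -- The polynomial `-a`, written as the move `0 + (-1) T^0 a` so that linearity of the product
      -- applies.
      a⁻ = addMonomialMultiple [] (-F 1F) 0 a
      sum≡0 : ∀ n → coeff (l₁ *L polyL a) n +F coeff (k₁ *L polyL b) n ≡ 0F
      sum≡0 n = trans (sym (coeff-+ (l₁ *L polyL a) (k₁ *L polyL b) n)) (fw≡0 n)
      form-zero : ∀ l k → IsZero (polyL a) → IsZero (polyL b) → IsZero (form l k (a , b))
      form-zero l k a≡0 b≡0 n = trans (coeff-+ (l *L polyL a) (k *L polyL b) n)
        (trans (cong₂ _+F_ (*L-zeroʳ l {polyL a} a≡0 n) (*L-zeroʳ k {polyL b} b≡0 n)) (+-identityʳ 0F))
      b≢0 : ¬ IsZero (polyL b)
      b≢0 b≡0 = det≢0 (det-zeroʳ v (a , b) fw≡0 (form-zero l₂ k₂ a≡0 b≡0))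
        where
        a≡0 : IsZero (polyL a)
        a≡0 = *L-nonzero em {l₁} {polyL a} l≢0 λ n → trans (sym (+-identityʳ _))
          (trans (cong (coeff (l₁ *L polyL a) n +F_) (sym (*L-zeroʳ k₁ {polyL b} b≡0 n))) (sum≡0 n))
      open ≡-Reasoning
      eq : (polyL b *L k₁) ≈L (polyL a⁻ *L l₁)
      eq n = begin
        coeff (polyL b *L k₁) n          ≡⟨ *L-comm (polyL b) k₁ n ⟩
        coeff (k₁ *L polyL b) n          ≡⟨ +-inverseʳ-unique _ _ (sum≡0 n) ⟩
        -F coeff (l₁ *L polyL a) n       ≡⟨ -1*x≈-x _ ⟨
        (-F 1F) *F coeff (l₁ *L polyL a) n ≡⟨ cong (λ m → (-F 1F) *F coeff (l₁ *L polyL a) m) (ℤ.+-identityʳ n) ⟨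
        (-F 1F) *F coeff (l₁ *L polyL a) (n - + 0) ≡⟨ +-identityˡ _ ⟨
        0F +F ((-F 1F) *F coeff (l₁ *L polyL a) (n - + 0))
          ≡⟨ cong (_+F ((-F 1F) *F coeff (l₁ *L polyL a) (n - + 0))) (*L-zeroʳ l₁ {polyL []} polyL-[]-zero n) ⟨
        coeff (l₁ *L polyL []) n +F ((-F 1F) *F coeff (l₁ *L polyL a) (n - + 0))
          ≡⟨ *L-linearʳ l₁ {polyL a⁻} {polyL []} {j = + 0} {z = polyL a} (polyL-addMonomialMultiple [] (-F 1F) 0 a) n ⟨
        coeff (l₁ *L polyL a⁻) n         ≡⟨ *L-comm l₁ (polyL a⁻) n ⟩
        coeff (polyL a⁻ *L l₁) n         ∎

  -- Degree bounds for degrees that may be minus infinity, and the conclusion.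

  HasDeg-+∞ : ∀ {x y a b e} → a + b ≡ e → x ≼ (a - + 1) → y ≼ (b - + 1) →
              ∀ d₁ d₂ → HasDeg x d₁ → HasDeg y d₂ → (d₁ +∞ d₂) ≤∞ just (e - + 2)
  HasDeg-+∞ {x} {y} {a} {b} refl x≼ y≼ (just d₁) (just d₂) δ₁ δ₂ =
    ℤ.≤-trans (ℤ.+-mono-≤ (HasDeg-≤ {x} δ₁ x≼) (HasDeg-≤ {y} δ₂ y≼)) (ℤ.≤-reflexive (eq a b))
    where
    eq : ∀ a b → a - + 1 + (b - + 1) ≡ a + b - + 2
    eq = solve-∀
  HasDeg-+∞ _ _ _ (just _) nothing _ _ = tt
  HasDeg-+∞ _ _ _ nothing _ _ _ = tt

  HasDeg-<∞ : ∀ {x a b} → a ≤ b → x ≼ (a - + 1) → ∀ d → HasDeg x d → d <∞ just b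
  HasDeg-<∞ {x} {a} a≤b x≼ (just d) δ = ℤ.<-≤-trans (ℤ.≤-<-trans (HasDeg-≤ {x} δ x≼) (≤-shift⇒< (ℤ.≤-refl {a}) (eq a))) a≤b
    where
    eq : ∀ a → a - a + + 1 ≡ a - (a - + 1)
    eq = solve-∀
  HasDeg-<∞ _ _ nothing _ = tt

theorem3p3 : ExcludedMiddle 0ℓ → {q : ℕ} (K : FiniteField q) →
    let open LaurentOps K in
    (l1 k1 l2 k2 : Laurent) →
    let det = (l1 *L k2) -L (l2 *L k1)
        L1 = λ (Q : Poly × Poly) → (l1 *L polyL (proj₁ Q)) +L (k1 *L polyL (proj₂ Q))
        L2 = λ (Q : Poly × Poly) → (l2 *L polyL (proj₁ Q)) +L (k2 *L polyL (proj₂ Q))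
        Good = λ (Q : Poly × Poly) (r1 r2 : Laurent) → ∀ d1 d2 e →
          HasDeg (L1 Q +L r1) d1 → HasDeg (L2 Q +L r2) d2 → HasDeg det (just e) →
          (d1 +∞ d2) ≤∞ just (e - + 2)
    in ¬ IsZero det →
       ((r1 r2 : Laurent) → Σ (Poly × Poly) (λ Q → Good Q r1 r2))
       × (¬ IsZero l1 → ¬ QuotientRational k1 l1 → (k : ℕ) (r1 r2 : Laurent) →
          Σ (Poly × Poly) (λ Q → Good Q r1 r2 ×
            (∀ d → HasDeg (L1 Q +L r1) d → d <∞ just (- (+ k)))))
theorem3p3 em K l1 k1 l2 k2 det≢0 = part₁ , part₂
  where
  open Series K
  open Forms l1 k1 l2 k2
  Δ = (l1 *L k2) -L (l2 *L k1)
  e = proj₁ (degree em Δ det≢0)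
  e-deg : HasDeg Δ (just e)
  e-deg = proj₂ (degree em Δ det≢0)
  open Euclid em e
  outcome : ∀ N → Outcome N
  outcome N = start N e₁ e₂ (basis (HasDeg-resp-≈ {Δ} {det e₁ e₂} det-e₁-e₂ e-deg))

  module _ (r1 r2 : Laurent) where
    X Y : Poly × Poly → Laurent
    X Q = form l1 k1 Q +L r1
    Y Q = form l2 k2 Q +L r2
    open Affine X Y (affine-translate l1 k1 r1) (affine-translate l2 k2 r2) public

    Good : Poly × Poly → Set
    Good Q = ∀ d1 d2 e′ → HasDeg (X Q) d1 → HasDeg (Y Q) d2 → HasDeg Δ (just e′) → (d1 +∞ d2) ≤∞ just (e′ - + 2)

    good : ∀ {a b Q} → a + b ≡ e → X Q ≼ (a - + 1) → Y Q ≼ (b - + 1) → Good Q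
    good {a} {b} {Q} a+b≡e XQ YQ d1 d2 e′ δ₁ δ₂ δ =
      HasDeg-+∞ {X Q} {Y Q} {a} {b} (trans a+b≡e (HasDeg-unique {Δ} e-deg δ)) XQ YQ d1 d2 δ₁ δ₂

  part₁ : (r1 r2 : Laurent) → Σ (Poly × Poly) (Good r1 r2)
  -- Part (1) asks nothing of `d`, so the target 0 is an arbitrary choice.
  part₁ r1 r2 = conclude (outcome (+ 0))
    where
    conclude : Outcome (+ 0) → Σ (Poly × Poly) (Good r1 r2)
    conclude (reduced v w d B β _ d+B≡e δ fw gv gw) =
      -- The lattice point `e₁` is an arbitrary starting point for the reduction.
      let Q , XQ , YQ = small-reduced r1 r2 {v} {w} e₁ β d+B≡e δ fw gv gw
      in Q , good r1 r2 {d} {B} {Q} d+B≡e XQ YQ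
    conclude (degenerate v w β fw≡0) =
      let a , b , a+b≡e , Q , XQ , YQ = small-degenerate r1 r2 {v} {w} e₁ β fw≡0
      in Q , good r1 r2 {a} {b} {Q} a+b≡e XQ YQ

  part₂ : ¬ IsZero l1 → ¬ QuotientRational k1 l1 → (k : ℕ) (r1 r2 : Laurent) →
          Σ (Poly × Poly) (λ Q → Good r1 r2 Q × (∀ d → HasDeg (X r1 r2 Q) d → d <∞ just (- (+ k))))
  -- With `d` at most `-k`, the box bound `d - 1` on the degree of the first coordinate is strictly
  -- below `-k`.
  part₂ l1≢0 irrational k r1 r2 = conclude (outcome (- (+ k)))
    where
    conclude : Outcome (- (+ k)) → Σ (Poly × Poly) (λ Q → Good r1 r2 Q × (∀ d → HasDeg (X r1 r2 Q) d → d <∞ just (- (+ k))))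
    conclude (reduced v w d B β d≤-k d+B≡e δ fw gv gw) =
      let Q , XQ , YQ = small-reduced r1 r2 {v} {w} e₁ β d+B≡e δ fw gv gw
      in Q , good r1 r2 {d} {B} {Q} d+B≡e XQ YQ , HasDeg-<∞ {X r1 r2 Q} d≤-k XQ
    conclude (degenerate v w β fw≡0) =
      ⊥-elim (irrational (degenerate⇒rational em {v} {w}
        (λ det≡0 → IsZero⇒¬HasDeg {det v w} det≡0 (deg-det β)) fw≡0 l1≢0))
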